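{- For every integer $l\ge 3$ there is no Neumaier graph with parameters $(6l+3,\,4l+2,\,3l;\,l+1,\,2l+1)$.
   Context: All graphs are finite, simple, undirected. A regular graph is $\lambda$-edge-regular if it has at least one edge and any two adjacent vertices have exactly $\lambda$ common neighbours. An edge-regular graph with parameters $(v,k,\lambda)$ has $v$ vertices, is $k$-regular and $\lambda$-edge-regular. For a regular graph, a clique $S$ is $e$-regular ($e>0$) if every vertex outside $S$ has exactly $e$ neighbours in $S$. A Neumaier graph with parameters $(v,k,\lambda;e,s)$ is a non-complete edge-regular graph with parameters $(v,k,\lambda)$ containing an $e$-regular clique of size $s$. -}

module Defs where

open import Data.Bool.Base using (Bool; true; false)
open import Data.Fin.Base using (Fin)
open import Data.Fin.Subset using (Subset; _∈_; _∉_; _∩_; ∣_∣)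
open import Data.Nat.Base using (ℕ; _>_)
open import Data.Product.Base using (∃-syntax)
open import Data.Vec.Base using (tabulate)
open import Relation.Binary.PropositionalEquality using (_≡_; _≢_)
open import Relation.Nullary using (¬_)

-- A finite simple undirected graph with v vertices, its vertices labelled by Fin v.
record Graph (v : ℕ) : Set where
  field
    adj       : Fin v → Fin v → Bool
    symmetric : ∀ x y → adj x y ≡ adj y x
    loopless  : ∀ x → adj x x ≡ false

  infix 4 _~_
  _~_ : Fin v → Fin v → Set
  x ~ y = adj x y ≡ true

  neighbours : Fin v → Subset v
  neighbours x = tabulate (adj x)

  Complete : Set
  Complete = ∀ x y → x ≢ y → x ~ y

  Regular : ℕ → Set
  Regular k = ∀ x → ∣ neighbours x ∣ ≡ k

  IsClique : Subset v → Set
  IsClique S = ∀ x y → x ∈ S → y ∈ S → x ≢ y → x ~ y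

record IsEdgeRegular {v : ℕ} (G : Graph v) (k λ′ : ℕ) : Set where
  open Graph G
  field
    regular          : Regular k
    hasEdge          : ∃[ x ] ∃[ y ] x ~ y
    commonNeighbours : ∀ x y → x ~ y → ∣ neighbours x ∩ neighbours y ∣ ≡ λ′

record IsRegularClique {v : ℕ} (G : Graph v) (e : ℕ) (S : Subset v) : Set where
  open Graph G
  field
    clique            : IsClique S
    e>0               : e > 0
    outsideNeighbours : ∀ x → x ∉ S → ∣ neighbours x ∩ S ∣ ≡ e

record NeumaierGraph (v k λ′ e s : ℕ) : Set where
  field
    graph         : Graph v
    nonComplete   : ¬ Graph.Complete graph
    edgeRegular   : IsEdgeRegular graph k λ′
    S             : Subset v
    regularClique : IsRegularClique graph e S
    cliqueSize    : ∣ S ∣ ≡ s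

{-# OPTIONS --safe #-}

-- In the complement H of such a graph every vertex has degree 2l, two distinct non-adjacent vertices
-- have l − 1 common neighbours, and S is an independent set meeting the neighbourhood of each outside
-- vertex in l points.  Counting paths of length two from a vertex x gives Σ_{z ~ x} |N(x) ∩ N(z)| = 2,
-- so x lies in exactly one triangle.  Let {s, t, t′} be the triangle through some s ∈ S.  As t ∉ S, it
-- has l neighbours outside S, hence, l being at least 3, two such neighbours u, w besides t′.
-- Neither tu nor tw lies in a triangle, so u and w are non-adjacent and N(u) ∩ S, N(w) ∩ S are
-- l-subsets of the (l + 1)-set S ∖ N(t): they share at least l − 1 points.  Together with t this
-- makes l common neighbours of u and w, one too many.
module Submission where

open import Defs
open import Data.Nat.Base using (ℕ; _+_; _*_; _≥_)
open import Relation.Nullary using (¬_)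
open import Data.Bool.Base using (Bool; true; false; not; _∧_)
open import Data.Bool.Properties using (∧-idem; ∧-zeroʳ)
open import Data.Empty using (⊥)
open import Data.Fin.Base using (Fin; zero; suc)
open import Data.Fin.Properties using (_≟_)
open import Data.Fin.Subset using (Subset; _∩_; ∣_∣)
open import Data.Nat.Base using (zero; suc; _≤_; _<_; z≤n; s≤s)
open import Data.Nat.Properties
  using (+-*-semiring; +-cancelʳ-≡; +-cancelʳ-≤; +-mono-≤; +-monoˡ-≤; +-monoʳ-≤;
         +-assoc; +-comm; +-identityʳ; *-comm; *-identityʳ; *-zeroʳ;
         ≤-refl; ≤-trans; m≤m+n; m≤n+m; n<1+n; n≮n; module ≤-Reasoning)
open import Data.Nat.Tactic.RingSolver using (solve-∀)
open import Data.Product.Base using (∃-syntax; _×_; _,_)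
open import Data.Vec.Base using ([]; _∷_; lookup)
open import Data.Vec.Properties using (lookup-zipWith; lookup∘tabulate; lookup⇒[]=; []=⇒lookup)
open import Function.Base using (_∘_)
open import Relation.Binary.PropositionalEquality
  using (_≡_; _≢_; _≗_; refl; sym; trans; cong; cong₂; subst; module ≡-Reasoning)
open import Relation.Nullary using (yes; no; does; contradiction)
open import Algebra.Properties.Semiring.Sum +-*-semiring
  using (sum; sum-cong-≗; ∑-distrib-+; ∑-comm; *-distribˡ-sum)

private
  variable
    n : ℕ

-- Sums over Fin n

sum-const : ∀ n c → sum {n} (λ _ → c) ≡ n * c
sum-const zero    c = refl
sum-const (suc n) c = cong (c +_) (sum-const n c)

sum-mono-≤ : {f g : Fin n → ℕ} → (∀ i → f i ≤ g i) → sum f ≤ sum g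
sum-mono-≤ {zero}  f≤g = z≤n
sum-mono-≤ {suc n} f≤g = +-mono-≤ (f≤g zero) (sum-mono-≤ (f≤g ∘ suc))

term≤sum : (f : Fin n → ℕ) (i : Fin n) → f i ≤ sum f
term≤sum f zero    = m≤m+n _ _
term≤sum f (suc i) = ≤-trans (term≤sum (f ∘ suc) i) (m≤n+m _ (f zero))

sum-positive : (f : Fin n → ℕ) → 0 < sum f → ∃[ i ] 0 < f i
sum-positive {suc n} f 0<Σ with f zero in eq
... | suc _ = zero , subst (0 <_) (sym eq) (s≤s z≤n)
... | zero  with i , 0<fi ← sum-positive (f ∘ suc) 0<Σ = suc i , 0<fi

sum-+₃ : (f g h : Fin n → ℕ) → sum (λ i → f i + g i + h i) ≡ sum f + sum g + sum h
sum-+₃ f g h = trans (∑-distrib-+ (λ i → f i + g i) h) (cong (_+ sum h) (∑-distrib-+ f g))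

-- Counting the points where a Boolean function holds

𝟙 : Bool → ℕ
𝟙 true  = 1
𝟙 false = 0

𝟙-∧ : ∀ a b → 𝟙 (a ∧ b) ≡ 𝟙 a * 𝟙 b
𝟙-∧ true  b = sym (+-identityʳ (𝟙 b))
𝟙-∧ false b = refl

∧-true : ∀ {a b} → a ∧ b ≡ true → a ≡ true × b ≡ true
∧-true {true} {true} _ = refl , refl

-- Cardinalities are recast as sums of 0/1 terms: double counting becomes an exchange of sums, and
-- inclusion-exclusion a pointwise check on truth values.
# : (Fin n → Bool) → ℕ
# f = sum (𝟙 ∘ f)

#-cong : {f g : Fin n → Bool} → f ≗ g → # f ≡ # g
#-cong f≗g = sum-cong-≗ (cong 𝟙 ∘ f≗g)

#-positive : (f : Fin n → Bool) → 0 < # f → ∃[ i ] f i ≡ true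
#-positive f 0<# with i , 0<fi ← sum-positive (𝟙 ∘ f) 0<# = i , 𝟙-positive (f i) 0<fi
  where
  𝟙-positive : ∀ a → 0 < 𝟙 a → a ≡ true
  𝟙-positive true _ = refl

#-member : (f : Fin n → Bool) {i : Fin n} → f i ≡ true → 0 < # f
#-member f {i} fi = subst (λ b → 𝟙 b ≤ # f) fi (term≤sum (𝟙 ∘ f) i)

∣p∣≡# : (p : Subset n) → ∣ p ∣ ≡ # (lookup p)
∣p∣≡# []          = refl
∣p∣≡# (true  ∷ p) = cong suc (∣p∣≡# p)
∣p∣≡# (false ∷ p) = ∣p∣≡# p

∣p∩q∣≡# : (p q : Subset n) → ∣ p ∩ q ∣ ≡ # (λ z → lookup p z ∧ lookup q z)
∣p∩q∣≡# p q = trans (∣p∣≡# (p ∩ q)) (#-cong (λ z → lookup-zipWith _∧_ z p q))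

-- Indicators of single points and the choice of distinct points

infix 4 _==_
_==_ : Fin n → Fin n → Bool
i == j = does (i ≟ j)

#-singleton : (i : Fin n) → # (i ==_) ≡ 1
#-singleton {suc n} zero    = cong suc (trans (sum-const n 0) (*-zeroʳ n))
#-singleton {suc n} (suc i) = #-singleton i

-- Only an inequality is claimed, so it covers both cases: `f` may or may not hold at `i`.
#-remove : (f : Fin n → Bool) (i : Fin n) → # f ≤ # (λ z → f z ∧ not (i == z)) + 1
#-remove f i = begin
  # f                                              ≤⟨ sum-mono-≤ (λ z → pointwise (f z) (i == z)) ⟩
  sum (λ z → 𝟙 (f z ∧ not (i == z)) + 𝟙 (i == z))  ≡⟨ ∑-distrib-+ (λ z → 𝟙 (f z ∧ not (i == z))) (λ z → 𝟙 (i == z)) ⟩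
  # (λ z → f z ∧ not (i == z)) + # (i ==_)         ≡⟨ cong (# (λ z → f z ∧ not (i == z)) +_) (#-singleton i) ⟩
  # (λ z → f z ∧ not (i == z)) + 1                 ∎
  where
  open ≤-Reasoning
  pointwise : ∀ a d → 𝟙 a ≤ 𝟙 (a ∧ not d) + 𝟙 d
  pointwise true  true  = ≤-refl
  pointwise true  false = ≤-refl
  pointwise false _     = z≤n

not-==⇒≢ : {i j : Fin n} → not (i == j) ≡ true → i ≢ j
not-==⇒≢ {i = i} {j} eq i≡j with i ≟ j
... | no i≢j = i≢j i≡j
not-==⇒≢ () _ | yes _

-- Discarding `i` costs at most one of the three points and discarding the point `j` then found
-- costs at most one more, so a point remains for `k`. It serves to find two outer neighbours of `t`
-- other than `t′`.
two-points-besides : (f : Fin n → Bool) (i : Fin n) → 3 ≤ # f →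
  ∃[ j ] ∃[ k ] f j ≡ true × f k ≡ true × i ≢ j × i ≢ k × j ≢ k
two-points-besides f i 3≤#f
  with 2≤#g ← +-cancelʳ-≤ 1 2 _ (≤-trans 3≤#f (#-remove f i))
  with j , gj ← #-positive (λ z → f z ∧ not (i == z)) (≤-trans (s≤s z≤n) 2≤#g)
  with k , hk ← #-positive (λ z → (f z ∧ not (i == z)) ∧ not (j == z))
                  (+-cancelʳ-≤ 1 1 _ (≤-trans 2≤#g (#-remove _ j)))
  with fj , i≠j ← ∧-true gj
  with gk , j≠k ← ∧-true hk
  with fk , i≠k ← ∧-true gk
  = j , k , fj , fk , not-==⇒≢ i≠j , not-==⇒≢ i≠k , not-==⇒≢ j≠k

-- Since the points are distinct, at most one of their three indicators is nonzero at any place, and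
-- there `g` is at least 1.
three-positive-terms : (g : Fin n → ℕ) {i j k : Fin n} → i ≢ j → i ≢ k → j ≢ k →
  0 < g i → 0 < g j → 0 < g k → 3 ≤ sum g
three-positive-terms g {i} {j} {k} i≢j i≢k j≢k gi gj gk = begin
  3                                                 ≡⟨ cong₂ _+_ (cong₂ _+_ (#-singleton i) (#-singleton j)) (#-singleton k) ⟨
  # (i ==_) + # (j ==_) + # (k ==_)                 ≡⟨ sum-+₃ (λ z → 𝟙 (i == z)) (λ z → 𝟙 (j == z)) (λ z → 𝟙 (k == z)) ⟨
  sum (λ z → 𝟙 (i == z) + 𝟙 (j == z) + 𝟙 (k == z))  ≤⟨ sum-mono-≤ pointwise ⟩
  sum g                                             ∎
  where
  open ≤-Reasoning
  pointwise : ∀ z → 𝟙 (i == z) + 𝟙 (j == z) + 𝟙 (k == z) ≤ g z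
  pointwise z with i ≟ z | j ≟ z | k ≟ z
  ... | yes refl | yes refl | _        = contradiction refl i≢j
  ... | yes refl | no _     | yes refl = contradiction refl i≢k
  ... | yes refl | no _     | no _     = gi
  ... | no _     | yes refl | yes refl = contradiction refl j≢k
  ... | no _     | yes refl | no _     = gj
  ... | no _     | no _     | yes refl = gk
  ... | no _     | no _     | no _     = z≤n

-- Degrees and common neighbours

module GraphCounts {v : ℕ} (G : Graph v) where
  open Graph G public

  degree : Fin v → ℕ
  degree x = # (adj x)

  common : Fin v → Fin v → ℕ
  common x y = # (λ z → adj x z ∧ adj y z)

  degreeInto : (Fin v → Bool) → Fin v → ℕ
  degreeInto σ x = # (λ z → adj x z ∧ σ z)

  ∣neighbours∣ : ∀ x → ∣ neighbours x ∣ ≡ degree x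
  ∣neighbours∣ x = trans (∣p∣≡# (neighbours x)) (#-cong (lookup∘tabulate (adj x)))

  ∣neighbours∩neighbours∣ : ∀ x y → ∣ neighbours x ∩ neighbours y ∣ ≡ common x y
  ∣neighbours∩neighbours∣ x y = trans (∣p∩q∣≡# (neighbours x) (neighbours y))
    (#-cong (λ z → cong₂ _∧_ (lookup∘tabulate (adj x) z) (lookup∘tabulate (adj y) z)))

  ∣neighbours∩S∣ : ∀ x S → ∣ neighbours x ∩ S ∣ ≡ degreeInto (lookup S) x
  ∣neighbours∩S∣ x S = trans (∣p∩q∣≡# (neighbours x) S)
    (#-cong (λ z → cong (_∧ lookup S z) (lookup∘tabulate (adj x) z)))

  ~⇒≢ : ∀ {x y} → x ~ y → x ≢ y
  ~⇒≢ {x} x~x refl with () ← trans (sym x~x) (loopless x)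

  ~-sym : ∀ {x y} → x ~ y → y ~ x
  ~-sym {x} {y} x~y = trans (symmetric y x) x~y

  degree-split : ∀ (σ : Fin v → Bool) x → degreeInto (not ∘ σ) x + degreeInto σ x ≡ degree x
  degree-split σ x = trans
    (sym (∑-distrib-+ (λ z → 𝟙 (adj x z ∧ not (σ z))) (λ z → 𝟙 (adj x z ∧ σ z))))
    (sum-cong-≗ (λ z → pointwise (adj x z) (σ z)))
    where
    pointwise : ∀ a s → 𝟙 (a ∧ not s) + 𝟙 (a ∧ s) ≡ 𝟙 a
    pointwise true  true  = refl
    pointwise true  false = refl
    pointwise false _     = refl

  -- Double counting: exchanging the sums groups the paths by midpoint, and each of the `k`
  -- neighbours of `x` is the midpoint of `k` paths. Paths returning to `x` are included.
  twoPaths : ∀ {k} → (∀ x → degree x ≡ k) → ∀ x → sum (common x) ≡ k * k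
  twoPaths {k} regular x = begin
    sum (λ z → sum (λ y → 𝟙 (adj x y ∧ adj z y)))  ≡⟨ ∑-comm (λ z y → 𝟙 (adj x y ∧ adj z y)) ⟩
    sum (λ y → sum (λ z → 𝟙 (adj x y ∧ adj z y)))  ≡⟨ sum-cong-≗ throughMidpoint ⟩
    sum (λ y → k * 𝟙 (adj x y))                    ≡⟨ *-distribˡ-sum k (𝟙 ∘ adj x) ⟨
    k * degree x                                   ≡⟨ cong (k *_) (regular x) ⟩
    k * k                                          ∎
    where
    open ≡-Reasoning
    throughMidpoint : ∀ y → sum (λ z → 𝟙 (adj x y ∧ adj z y)) ≡ k * 𝟙 (adj x y)
    throughMidpoint y = begin
      sum (λ z → 𝟙 (adj x y ∧ adj z y))      ≡⟨ sum-cong-≗ (λ z → trans (𝟙-∧ (adj x y) (adj z y))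
                                                  (cong (λ b → 𝟙 (adj x y) * 𝟙 b) (symmetric z y))) ⟩
      sum (λ z → 𝟙 (adj x y) * 𝟙 (adj y z))  ≡⟨ *-distribˡ-sum (𝟙 (adj x y)) (𝟙 ∘ adj y) ⟨
      𝟙 (adj x y) * degree y                 ≡⟨ cong (𝟙 (adj x y) *_) (regular y) ⟩
      𝟙 (adj x y) * k                        ≡⟨ *-comm (𝟙 (adj x y)) k ⟩
      k * 𝟙 (adj x y)                        ∎

  -- This is twice the number of triangles through `x`: each triangle is counted once for either of
  -- its other two vertices.
  triangles : Fin v → ℕ
  triangles x = sum (λ z → 𝟙 (adj x z) * common x z)

  -- The paths of length two from x are sorted by their endpoint: x itself, a neighbour of x, or a
  -- non-neighbour; terms are moved across so that no subtraction occurs.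
  twoPathsByEndpoint : ∀ {k μ} → (∀ x → degree x ≡ k) →
    (∀ x y → x ≢ y → adj x y ≡ false → common x y ≡ μ) →
    ∀ x → k * k + μ * k + μ ≡ triangles x + v * μ + k
  twoPathsByEndpoint {k} {μ} regular nonadjacent x = begin
    k * k + μ * k + μ
      ≡⟨ cong₂ _+_ (cong₂ _+_ (twoPaths regular x) (c*Σ μ (adj x) (regular x))) (c*Σ₌ μ) ⟨
    sum (common x) + sum (λ z → μ * 𝟙 (adj x z)) + sum (λ z → μ * 𝟙 (x == z))
      ≡⟨ sum-+₃ (common x) (λ z → μ * 𝟙 (adj x z)) (λ z → μ * 𝟙 (x == z)) ⟨
    sum (λ z → common x z + μ * 𝟙 (adj x z) + μ * 𝟙 (x == z))
      ≡⟨ sum-cong-≗ pointwise ⟩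
    sum (λ z → 𝟙 (adj x z) * common x z + μ + k * 𝟙 (x == z))
      ≡⟨ sum-+₃ (λ z → 𝟙 (adj x z) * common x z) (λ _ → μ) (λ z → k * 𝟙 (x == z)) ⟩
    triangles x + sum {v} (λ _ → μ) + sum (λ z → k * 𝟙 (x == z))
      ≡⟨ cong₂ _+_ (cong (triangles x +_) (sum-const v μ)) (c*Σ₌ k) ⟩
    triangles x + v * μ + k
      ∎
    where
    open ≡-Reasoning
    c*Σ : ∀ c f {a} → # f ≡ a → sum (λ z → c * 𝟙 (f z)) ≡ c * a
    c*Σ c f eq = trans (sym (*-distribˡ-sum c (𝟙 ∘ f))) (cong (c *_) eq)

    c*Σ₌ : ∀ c → sum (λ z → c * 𝟙 (x == z)) ≡ c
    c*Σ₌ c = trans (c*Σ c (x ==_) (#-singleton x)) (*-identityʳ c)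

    common-refl : common x x ≡ k
    common-refl = trans (#-cong (λ z → ∧-idem (adj x z))) (regular x)

    atStart : ∀ k μ → k + μ * 0 + μ * 1 ≡ 0 + μ + k * 1
    atStart = solve-∀
    adjacent : ∀ k c μ → c + μ * 1 + μ * 0 ≡ (c + 0) + μ + k * 0
    adjacent = solve-∀
    otherwise : ∀ k μ → μ + μ * 0 + μ * 0 ≡ 0 + μ + k * 0
    otherwise = solve-∀

    pointwise : ∀ z → common x z + μ * 𝟙 (adj x z) + μ * 𝟙 (x == z) ≡
                      𝟙 (adj x z) * common x z + μ + k * 𝟙 (x == z)
    pointwise z with x ≟ z
    ... | yes refl rewrite loopless x | common-refl = atStart k μ
    ... | no x≢z with adj x z in eq
    ...   | true  = adjacent k (common x z) μ
    ...   | false rewrite nonadjacent x z x≢z eq = otherwise k μ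

  -- The neighbourhood of `t` is disjoint from those of `u` and `w`. Hence a point of `σ` is counted
  -- more than once on the left only if it is adjacent to both `u` and `w`; it is then counted
  -- twice, and the second summand on the right pays for the excess.
  crowding : ∀ (σ : Fin v → Bool) {t u w} → common t u ≡ 0 → common t w ≡ 0 →
    degreeInto σ t + degreeInto σ u + degreeInto σ w ≤ # σ + # (λ z → (adj u z ∧ adj w z) ∧ σ z)
  crowding σ {t} {u} {w} tu tw = begin
    degreeInto σ t + degreeInto σ u + degreeInto σ w
      ≡⟨ sum-+₃ (λ z → 𝟙 (adj t z ∧ σ z)) (λ z → 𝟙 (adj u z ∧ σ z)) (λ z → 𝟙 (adj w z ∧ σ z)) ⟨
    sum (λ z → 𝟙 (adj t z ∧ σ z) + 𝟙 (adj u z ∧ σ z) + 𝟙 (adj w z ∧ σ z))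
      ≤⟨ sum-mono-≤ (λ z → pointwise (adj t z) (adj u z) (adj w z) (σ z) (disjoint tu z) (disjoint tw z)) ⟩
    sum (λ z → 𝟙 (σ z) + 𝟙 ((adj u z ∧ adj w z) ∧ σ z))
      ≡⟨ ∑-distrib-+ (𝟙 ∘ σ) (λ z → 𝟙 ((adj u z ∧ adj w z) ∧ σ z)) ⟩
    # σ + # (λ z → (adj u z ∧ adj w z) ∧ σ z)
      ∎
    where
    open ≤-Reasoning
    disjoint : ∀ {y} → common t y ≡ 0 → ∀ z → adj t z ∧ adj y z ≢ true
    disjoint {y} none z both = n≮n 0 (subst (0 <_) none (#-member (λ z → adj t z ∧ adj y z) both))

    pointwise : ∀ a b c s → a ∧ b ≢ true → a ∧ c ≢ true →
                𝟙 (a ∧ s) + 𝟙 (b ∧ s) + 𝟙 (c ∧ s) ≤ 𝟙 s + 𝟙 ((b ∧ c) ∧ s)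
    pointwise true  true  _     _     ab _  = contradiction refl ab
    pointwise true  false true  _     _  ac = contradiction refl ac
    pointwise true  false false true  _  _  = ≤-refl
    pointwise true  false false false _  _  = z≤n
    pointwise false true  true  true  _  _  = ≤-refl
    pointwise false true  true  false _  _  = z≤n
    pointwise false true  false true  _  _  = ≤-refl
    pointwise false true  false false _  _  = z≤n
    pointwise false false true  true  _  _  = ≤-refl
    pointwise false false true  false _  _  = z≤n
    pointwise false false false _     _  _  = z≤n

  -- The extra 1 is `t` itself, a common neighbour of `u` and `w` that is missed by the count inside
  -- `σ`.
  common-outside : ∀ (σ : Fin v → Bool) {t u w} → t ~ u → t ~ w → σ t ≡ false →
    # (λ z → (adj u z ∧ adj w z) ∧ σ z) + 1 ≤ common u w
  common-outside σ {t} {u} {w} t~u t~w t∉σ = begin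
    # uwσ + 1                          ≡⟨ cong (# uwσ +_) (#-singleton t) ⟨
    # uwσ + # (t ==_)                  ≡⟨ ∑-distrib-+ (𝟙 ∘ uwσ) (λ z → 𝟙 (t == z)) ⟨
    sum (λ z → 𝟙 (uwσ z) + 𝟙 (t == z))  ≤⟨ sum-mono-≤ pointwise ⟩
    common u w                         ∎
    where
    open ≤-Reasoning
    uwσ : Fin v → Bool
    uwσ z = (adj u z ∧ adj w z) ∧ σ z

    drop : ∀ b s → 𝟙 (b ∧ s) + 0 ≤ 𝟙 b
    drop true  true  = ≤-refl
    drop true  false = z≤n
    drop false _     = z≤n

    pointwise : ∀ z → 𝟙 (uwσ z) + 𝟙 (t == z) ≤ 𝟙 (adj u z ∧ adj w z)
    pointwise z with t ≟ z
    ... | yes refl rewrite ~-sym t~u | ~-sym t~w | t∉σ = ≤-refl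
    ... | no _ = drop (adj u z ∧ adj w z) (σ z)

-- Complements

complement : {v : ℕ} → Graph v → Graph v
complement {v} G = record
  { adj       = λ x y → not (adj x y) ∧ not (x == y)
  ; symmetric = λ x y → cong₂ (λ a d → not a ∧ not d) (symmetric x y) (==-sym x y)
  ; loopless  = λ x → trans (cong (λ d → not (adj x x) ∧ not d) (==-refl x)) (∧-zeroʳ _)
  }
  where
  open Graph G
  ==-refl : (x : Fin v) → (x == x) ≡ true
  ==-refl x with x ≟ x
  ... | yes _  = refl
  ... | no x≢x = contradiction refl x≢x

  ==-sym : (x y : Fin v) → (x == y) ≡ (y == x)
  ==-sym x y with x ≟ y | y ≟ x
  ... | yes _   | yes _   = refl
  ... | no _    | no _    = refl
  ... | yes x≡y | no y≢x  = contradiction (sym x≡y) y≢x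
  ... | no x≢y  | yes y≡x = contradiction (sym y≡x) x≢y

module ComplementCounts {v : ℕ} (G : Graph v) where
  open GraphCounts G
  module H = GraphCounts (complement G)

  -- Each vertex is exactly one of: a neighbour of `x` in the complement, a neighbour in `G`, or
  -- `x`. The last possibility gives the 1.
  co-degree : ∀ x → H.degree x + degree x + 1 ≡ v
  co-degree x = begin
    H.degree x + degree x + 1                                    ≡⟨ cong (H.degree x + degree x +_) (#-singleton x) ⟨
    H.degree x + degree x + # (x ==_)                            ≡⟨ sum-+₃ (𝟙 ∘ H.adj x) (𝟙 ∘ adj x) (λ z → 𝟙 (x == z)) ⟨
    sum (λ z → 𝟙 (H.adj x z) + 𝟙 (adj x z) + 𝟙 (x == z))         ≡⟨ sum-cong-≗ pointwise ⟩
    sum {v} (λ _ → 1)                                            ≡⟨ sum-const v 1 ⟩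
    v * 1                                                        ≡⟨ *-identityʳ v ⟩
    v                                                            ∎
    where
    open ≡-Reasoning
    pointwise : ∀ z → 𝟙 (H.adj x z) + 𝟙 (adj x z) + 𝟙 (x == z) ≡ 1
    pointwise z with x ≟ z
    ... | yes refl rewrite loopless x = refl
    ... | no _ with adj x z
    ...   | true  = refl
    ...   | false = refl

  -- Inclusion-exclusion for the two neighbourhoods in `G`. No correction for `x` and `y` is needed:
  -- being adjacent, they lie in each other's neighbourhood, hence in the union.
  co-common : ∀ x y → x ~ y → H.common x y + degree x + degree y ≡ v + common x y
  co-common x y x~y = begin
    H.common x y + degree x + degree y            ≡⟨ sum-+₃ (λ z → 𝟙 (H.adj x z ∧ H.adj y z)) (𝟙 ∘ adj x) (𝟙 ∘ adj y) ⟨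
    sum (λ z → 𝟙 (H.adj x z ∧ H.adj y z) + 𝟙 (adj x z) + 𝟙 (adj y z))
                                                  ≡⟨ sum-cong-≗ pointwise ⟩
    sum (λ z → 1 + 𝟙 (adj x z ∧ adj y z))         ≡⟨ ∑-distrib-+ (λ _ → 1) (λ z → 𝟙 (adj x z ∧ adj y z)) ⟩
    sum {v} (λ _ → 1) + common x y                ≡⟨ cong (_+ common x y) (trans (sum-const v 1) (*-identityʳ v)) ⟩
    v + common x y                                ∎
    where
    open ≡-Reasoning
    pointwise : ∀ z → 𝟙 (H.adj x z ∧ H.adj y z) + 𝟙 (adj x z) + 𝟙 (adj y z) ≡ 1 + 𝟙 (adj x z ∧ adj y z)
    pointwise z with x ≟ z | y ≟ z
    ... | yes refl | yes refl = contradiction refl (~⇒≢ x~y)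
    ... | yes refl | no _     rewrite loopless x | ~-sym x~y = refl
    ... | no _     | yes refl rewrite loopless y | x~y = refl
    ... | no _     | no _ with adj x z | adj y z
    ...   | true  | true  = refl
    ...   | true  | false = refl
    ...   | false | true  = refl
    ...   | false | false = refl

  -- As `x` is not in `σ`, every point of `σ` differs from `x` and so is adjacent to it in exactly
  -- one of the two graphs.
  co-degreeInto : ∀ (σ : Fin v → Bool) x → σ x ≡ false → H.degreeInto σ x + degreeInto σ x ≡ # σ
  co-degreeInto σ x x∉σ = trans
    (sym (∑-distrib-+ (λ z → 𝟙 (H.adj x z ∧ σ z)) (λ z → 𝟙 (adj x z ∧ σ z))))
    (sum-cong-≗ pointwise)
    where
    pointwise : ∀ z → 𝟙 (H.adj x z ∧ σ z) + 𝟙 (adj x z ∧ σ z) ≡ 𝟙 (σ z)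
    pointwise z with x ≟ z
    ... | yes refl rewrite loopless x | x∉σ = refl
    ... | no _ with adj x z
    ...   | true  = refl
    ...   | false = +-identityʳ _

  co-nonadjacent : ∀ x y → x ≢ y → H.adj x y ≡ false → x ~ y
  co-nonadjacent x y x≢y x≁y with x ≟ y | adj x y
  ... | yes x≡y | _    = contradiction x≡y x≢y
  ... | no _    | true = refl

  co-adjacent : ∀ {x y} → H.adj x y ≡ true → adj x y ≡ false
  co-adjacent {x} {y} x~y with adj x y
  ... | false = refl

-- The complement of the graph, with σ the indicator function of S and m = l − 1.
module NoComplement (m : ℕ) (2≤m : 2 ≤ m) {v : ℕ} (order : v ≡ 6 * suc m + 3) (H : Graph v)
  (regular     : ∀ x → GraphCounts.degree H x ≡ 2 * suc m)
  (nonadjacent : ∀ x y → x ≢ y → Graph.adj H x y ≡ false → GraphCounts.common H x y ≡ m)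
  (σ           : Fin v → Bool)
  (size        : # σ ≡ 2 * suc m + 1)
  (independent : ∀ {x y} → Graph.adj H x y ≡ true → σ x ≡ true → σ y ≡ false)
  (into        : ∀ x → σ x ≡ false → GraphCounts.degreeInto H σ x ≡ suc m)
  where
  open GraphCounts H

  private
    l = suc m

  -- With degree `2 * l` and `m` common neighbours, the path count leaves 4l² + 2l(l - 1) + (l - 1)
  -- - (6l + 3)(l - 1) - 2l = 2. As each triangle counts twice, exactly one passes through `x`.
  triangles≡2 : ∀ x → triangles x ≡ 2
  triangles≡2 x = +-cancelʳ-≡ ((6 * l + 3) * m + 2 * l) _ _ (begin
    triangles x + ((6 * l + 3) * m + 2 * l)   ≡⟨ +-assoc (triangles x) _ _ ⟨
    triangles x + (6 * l + 3) * m + 2 * l     ≡⟨ cong (λ n → triangles x + n * m + 2 * l) order ⟨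
    triangles x + v * m + 2 * l               ≡⟨ twoPathsByEndpoint regular nonadjacent x ⟨
    2 * l * (2 * l) + m * (2 * l) + m         ≡⟨ identity m ⟩
    2 + ((6 * l + 3) * m + 2 * l)             ∎)
    where
    open ≡-Reasoning
    identity : ∀ m → 2 * suc m * (2 * suc m) + m * (2 * suc m) + m ≡
                     2 + ((6 * suc m + 3) * m + 2 * suc m)
    identity = solve-∀

  triangle-through : ∀ s → ∃[ t ] ∃[ t′ ] s ~ t × s ~ t′ × t ~ t′
  triangle-through s
    with t , pos ← sum-positive (λ z → 𝟙 (adj s z) * common s z) (subst (0 <_) (sym (triangles≡2 s)) (s≤s z≤n))
    -- The positive term forces `s ~ t`: were the value `false`, the term would reduce to 0.
    with adj s t in s~t
  ... | true with t′ , both ← #-positive (λ z → adj s z ∧ adj t z) (subst (0 <_) (+-identityʳ (common s t)) pos)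
             with s~t′ , t~t′ ← ∧-true both
             = t , t′ , s~t , s~t′ , t~t′

  triangle-term : ∀ {x y z} → x ~ y → x ~ z → y ~ z → 0 < 𝟙 (adj x y) * common x y
  triangle-term {x} {y} {z} x~y x~z y~z =
    subst (λ b → 0 < 𝟙 b * common x y) (sym x~y)
      (subst (0 <_) (sym (+-identityʳ (common x y)))
        (#-member (λ z → adj x z ∧ adj y z) (cong₂ _∧_ x~z y~z)))

  -- The triangle on `t`, `s`, `t′` already makes the terms of `triangles t` at `s` and at `t′`
  -- positive. A triangle on the edge `t u` would add a third positive term, but the sum is 2.
  triangle-unique : ∀ {t s t′ u} → t ~ s → t ~ t′ → s ~ t′ → t ~ u → s ≢ u → t′ ≢ u → common t u ≡ 0
  triangle-unique {t} {s} {t′} {u} t~s t~t′ s~t′ t~u s≢u t′≢u with common t u in eq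
  ... | zero  = refl
  ... | suc _ = contradiction
    (subst (3 ≤_) (triangles≡2 t)
      (three-positive-terms (λ z → 𝟙 (adj t z) * common t z) (~⇒≢ s~t′) s≢u t′≢u
        (triangle-term t~s t~t′ s~t′) (triangle-term t~t′ t~s (~-sym s~t′))
        (subst (λ b → 0 < 𝟙 b * common t u) (sym t~u)
          (subst (λ c → 0 < c + 0) (sym eq) (s≤s z≤n)))))
    (n≮n 2)

  degree-outside : ∀ x → σ x ≡ false → degreeInto (not ∘ σ) x ≡ l
  degree-outside x x∉σ = +-cancelʳ-≡ l _ _ (begin
    degreeInto (not ∘ σ) x + l               ≡⟨ cong (degreeInto (not ∘ σ) x +_) (into x x∉σ) ⟨
    degreeInto (not ∘ σ) x + degreeInto σ x  ≡⟨ degree-split σ x ⟩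
    degree x                                 ≡⟨ regular x ⟩
    l + (l + 0)                              ≡⟨ cong (l +_) (+-identityʳ l) ⟩
    l + l                                    ∎)
    where open ≡-Reasoning

  -- An edge is called free when it lies in no triangle. Chaining `crowding` with `common-outside`
  -- gives 3l + 1 ≤ (2l + 1) + (l - 1) = 3l.
  no-two-free-edges : ∀ {t u w} → u ≢ w → t ~ u → t ~ w → common t u ≡ 0 → common t w ≡ 0 →
    σ t ≡ false → σ u ≡ false → σ w ≡ false → ⊥
  no-two-free-edges {t} {u} {w} u≢w t~u t~w tu tw t∉σ u∉σ w∉σ = n≮n _ (begin-strict
    m + 2 * l + 1                                     <⟨ n<1+n _ ⟩
    suc (m + 2 * l + 1)                               ≡⟨ identity m ⟩
    l + l + l + 1                                     ≡⟨ cong (_+ 1) (cong₂ _+_ (cong₂ _+_ (into t t∉σ) (into u u∉σ)) (into w w∉σ)) ⟨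
    degreeInto σ t + degreeInto σ u + degreeInto σ w + 1
                                                      ≤⟨ +-monoˡ-≤ 1 (crowding σ tu tw) ⟩
    # σ + # uwσ + 1                                   ≡⟨ +-assoc (# σ) (# uwσ) 1 ⟩
    # σ + (# uwσ + 1)                                 ≤⟨ +-monoʳ-≤ (# σ) (common-outside σ t~u t~w t∉σ) ⟩
    # σ + common u w                                  ≡⟨ cong₂ _+_ size (nonadjacent u w u≢w u≁w) ⟩
    2 * l + 1 + m                                     ≡⟨ +-comm (2 * l + 1) m ⟩
    m + (2 * l + 1)                                   ≡⟨ +-assoc m (2 * l) 1 ⟨
    m + 2 * l + 1                                     ∎)
    where
    open ≤-Reasoning
    uwσ : Fin v → Bool
    uwσ z = (adj u z ∧ adj w z) ∧ σ z

    u≁w : adj u w ≡ false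
    u≁w with adj u w in u~w
    ... | false = refl
    -- Otherwise `w` would be a common neighbour of `t` and `u`, against `tu`.
    ... | true  = contradiction
      (subst (0 <_) tu (#-member (λ z → adj t z ∧ adj u z) (cong₂ _∧_ t~w u~w))) (n≮n 0)

    identity : ∀ m → suc (m + 2 * suc m + 1) ≡ suc m + suc m + suc m + 1
    identity = solve-∀

  no-triangle-at : ∀ {s} → σ s ≡ true → ∃[ t ] ∃[ t′ ] s ~ t × s ~ t′ × t ~ t′ → ⊥
  no-triangle-at {s} s∈σ (t , t′ , s~t , s~t′ , t~t′) = conclude
    -- Here `l ≥ 3` enters: of the `l` neighbours of `t` outside `σ`, at least two remain once `t′`
    -- is discarded.
    (two-points-besides (λ z → adj t z ∧ not (σ z)) t′
      (subst (3 ≤_) (sym (degree-outside t t∉σ)) (s≤s 2≤m)))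
    where
    t∉σ : σ t ≡ false
    t∉σ = independent s~t s∈σ

    outside : ∀ {u} → adj t u ∧ not (σ u) ≡ true → σ u ≡ false
    outside {u} tu with adj t u | σ u
    ... | true | false = refl

    neighbour : ∀ {u} → adj t u ∧ not (σ u) ≡ true → t ~ u
    neighbour tu with t~u , _ ← ∧-true tu = t~u

    free : ∀ {u} → adj t u ∧ not (σ u) ≡ true → t′ ≢ u → common t u ≡ 0
    free {u} tu t′≢u = triangle-unique (~-sym s~t) t~t′ s~t′ (neighbour tu) s≢u t′≢u
      where
      s≢u : s ≢ u
      s≢u refl with () ← trans (sym s∈σ) (outside tu)

    conclude : ∃[ u ] ∃[ w ] adj t u ∧ not (σ u) ≡ true × adj t w ∧ not (σ w) ≡ true ×
               t′ ≢ u × t′ ≢ w × u ≢ w → ⊥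
    conclude (u , w , tu , tw , t′≢u , t′≢w , u≢w) =
      no-two-free-edges u≢w (neighbour tu) (neighbour tw) (free tu t′≢u) (free tw t′≢w)
        t∉σ (outside tu) (outside tw)

  absurd : ⊥
  absurd with s , s∈σ ← #-positive σ (subst (0 <_) (sym (trans size (+-comm (2 * l) 1))) (s≤s z≤n))
    = no-triangle-at s∈σ (triangle-through s)

-- Transfer of the Neumaier parameters to the complement

mainTheorem3 : (l : ℕ) → l ≥ 3 →
    ¬ NeumaierGraph (6 * l + 3) (4 * l + 2) (3 * l) (l + 1) (2 * l + 1)
-- The complement has degree (6l + 3) - (4l + 2) - 1 = 2l. Its distinct non-adjacent pairs have (6l
-- + 3) + 3l - 2(4l + 2) = l - 1 common neighbours, and a vertex outside `S` has (2l + 1) - (l + 1)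
-- = l neighbours in `S`.
mainTheorem3 (suc m) (s≤s 2≤m) Γ = NoComplement.absurd m 2≤m refl (complement graph)
  co-regular co-nonadjacent-common (lookup S) ∣S∣ co-independent co-into
  where
  open NeumaierGraph Γ
  open IsEdgeRegular edgeRegular
  open IsRegularClique regularClique
  open GraphCounts graph
  open ComplementCounts graph
  open ≡-Reasoning
  l = suc m

  degree≡ : ∀ x → degree x ≡ 4 * l + 2
  degree≡ x = trans (sym (∣neighbours∣ x)) (regular x)

  co-regular : ∀ x → H.degree x ≡ 2 * l
  co-regular x = +-cancelʳ-≡ (4 * l + 2 + 1) _ _ (begin
    H.degree x + (4 * l + 2 + 1)  ≡⟨ +-assoc (H.degree x) _ 1 ⟨
    H.degree x + (4 * l + 2) + 1  ≡⟨ cong (λ d → H.degree x + d + 1) (degree≡ x) ⟨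
    H.degree x + degree x + 1     ≡⟨ co-degree x ⟩
    6 * l + 3                     ≡⟨ identity l ⟩
    2 * l + (4 * l + 2 + 1)       ∎)
    where
    identity : ∀ l → 6 * l + 3 ≡ 2 * l + (4 * l + 2 + 1)
    identity = solve-∀

  co-nonadjacent-common : ∀ x y → x ≢ y → H.adj x y ≡ false → H.common x y ≡ m
  co-nonadjacent-common x y x≢y x≁y = +-cancelʳ-≡ (k + k) _ _ (begin
    H.common x y + (k + k)                ≡⟨ +-assoc (H.common x y) k k ⟨
    H.common x y + k + k                  ≡⟨ cong₂ (λ c d → H.common x y + c + d) (degree≡ x) (degree≡ y) ⟨
    H.common x y + degree x + degree y    ≡⟨ co-common x y x~y ⟩
    6 * l + 3 + common x y                ≡⟨ cong (6 * l + 3 +_) (trans (sym (∣neighbours∩neighbours∣ x y)) (commonNeighbours x y x~y)) ⟩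
    -- The identity is stated in `m` rather than `l`, so that l - 1 occurs without subtraction.
    6 * l + 3 + 3 * l                     ≡⟨ identity m ⟩
    m + (k + k)                           ∎)
    where
    k = 4 * l + 2
    x~y : x ~ y
    x~y = co-nonadjacent x y x≢y x≁y
    identity : ∀ m → 6 * suc m + 3 + 3 * suc m ≡ m + (4 * suc m + 2 + (4 * suc m + 2))
    identity = solve-∀

  ∣S∣ : # (lookup S) ≡ 2 * l + 1
  ∣S∣ = trans (sym (∣p∣≡# S)) cliqueSize

  co-independent : ∀ {x y} → H.adj x y ≡ true → lookup S x ≡ true → lookup S y ≡ false
  co-independent {x} {y} x~y x∈S with lookup S y in y∈S
  ... | false = refl
  ... | true
    with () ← trans (sym (co-adjacent x~y))
                (clique x y (lookup⇒[]= x S x∈S) (lookup⇒[]= y S y∈S) (H.~⇒≢ x~y))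

  co-into : ∀ x → lookup S x ≡ false → H.degreeInto (lookup S) x ≡ l
  co-into x x∉S = +-cancelʳ-≡ (l + 1) _ _ (begin
    H.degreeInto (lookup S) x + (l + 1)                    ≡⟨ cong (H.degreeInto (lookup S) x +_) outside ⟨
    H.degreeInto (lookup S) x + degreeInto (lookup S) x    ≡⟨ co-degreeInto (lookup S) x x∉S ⟩
    # (lookup S)                                           ≡⟨ ∣S∣ ⟩
    2 * l + 1                                              ≡⟨ identity l ⟩
    l + (l + 1)                                            ∎)
    where
    outside : degreeInto (lookup S) x ≡ l + 1
    outside = trans (sym (∣neighbours∩S∣ x S))
      (outsideNeighbours x (λ x∈S → contradiction (trans (sym ([]=⇒lookup x∈S)) x∉S) λ ()))
    identity : ∀ l → 2 * l + 1 ≡ l + (l + 1)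
    identity = solve-∀
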